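{- Let $\mathcal{T}$ be a (stationary, finite) $k$-spacetree, $k\ge 2$, whose root is a square/cube in $\mathbb{R}^d$, $d\in\{2,3\}$, and let $\mathbb{M}$ be a finite set of particles with positions $x(m)\in\mathbb{R}^d$. Initially every particle is assigned to a leaf of $\mathcal{T}$ that covers its position. Run an arbitrary sequence of tree traversals, each consisting of one event $\mathrm{enterCell}(c)$ and one event $\mathrm{leaveCell}(c)$ per cell $c\in\mathcal{T}$, ordered in accordance with the traversal constraint, where the events perform the operations of the particle-in-tree (PIT) algorithm (traversal constraint and algorithm are given in the context). Then, whenever $\mathrm{enterCell}$ is invoked on a leaf $a\in\mathcal{T}$ and all its preamble operations have terminated, every particle assigned to $a$ at that moment has a position $x$ covered by $a$.
   Context: **Spacetree.** The root is a $d$-dimensional square/cube spanning the whole computational domain. A cell is refined by cutting it into $k$ equal parts along each coordinate axis, yielding $k^d$ child squares/cubes that tessellate it. For each cell one decides whether to refine further. The resulting finite set of cells is $\mathcal{T}$; write $a\sqsubseteq_{child\ of} b$ if $a$ is one of the $k^d$ children of $b$ ($b$ is then the parent of $a$). A cell without children is a leaf (unrefined); otherwise it is refined. A cell covers (contains) a position $x$ if $x$ lies in the square/cube it represents. **Traversal constraint.** In each traversal the events are ordered in time such that: if $a\sqsubseteq_{child\ of} b$, then $\mathrm{enterCell}(b)$ is executed before $\mathrm{enterCell}(a)$ and $\mathrm{leaveCell}(a)$ before $\mathrm{leaveCell}(b)$; and for every cell $c$, $\mathrm{enterCell}(c)$ is executed before $\mathrm{leaveCell}(c)$. Traversals are executed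 one after another. **PIT algorithm.** At any time each particle $m$ is assigned to (associated with) exactly one cell of $\mathcal{T}$. $\mathrm{enterCell}(c)$: 1. (Preamble) If $c$ is refined: for every $m$ assigned to $c$, identify a child $c'\sqsubseteq_{child\ of} c$ containing $x(m)$ and assign $m$ to $c'$ (drop). 2. Application-specific operations. 3. If $c$ is unrefined: for every $m$ assigned to $c$, update the position $x(m)$ (move). 4. Application-specific operations. $\mathrm{leaveCell}(c)$: 1. Application-specific operations. 2. (Epilogue) For every $m$ assigned to $c$: if $x(m)$ is not contained in $c$, assign $m$ to the parent $c'$ of $c$, i.e. $c\sqsubseteq_{child\ of} c'$ (lift). **Conventions.** The new position in a move is arbitrary (no bound on the distance travelled) except that particles always stay within the computational domain, i.e. within the root cell. Application-specific operations change neither particle positions nor particle assignments. -}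

module Defs where

open import Algebra.Apartness.Bundles using (HeytingCommutativeRing; HeytingField)
open import Algebra.Bundles using (CommutativeRing)
open import Data.Empty using (⊥-elim)
open import Data.Fin as Fin using (Fin; toℕ)
open import Data.List using (List; []; _∷_)
open import Data.List.Membership.Propositional using (_∈_)
open import Data.List.Relation.Unary.Any using (index)
open import Data.List.Relation.Unary.Unique.Propositional using (Unique)
open import Data.Nat as ℕ using (ℕ; suc; zero; NonZero; NonTrivial; nonTrivial⇒nonZero)
open import Data.Product using (∃; _×_; proj₁; proj₂)
open import Data.Sum using (_⊎_; inj₁; inj₂)
open import Data.Vec using (Vec; lookup)
open import Data.Vec.Functional using (Vector)
import Data.Vec.Functional.Relation.Binary.Equality.Setoid as VecEq
open import Level using (Level; _⊔_) renaming (suc to lsuc)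
open import Relation.Binary.Construct.Composition using (_;_)
open import Relation.Binary.Core using (Rel)
open import Relation.Binary.PropositionalEquality using (_≡_)
open import Relation.Binary.Structures using (IsStrictPartialOrder)
open import Relation.Nullary using (¬_)
import Algebra.Apartness.Properties.HeytingCommutativeRing as HeytingProperties
import Algebra.Properties.Monoid.Mult as Mult
import Algebra.Properties.Ring as RingProperties

-- The real numbers, axiomatised as an Archimedean, Cauchy complete ordered
-- field.  The axioms are the constructive ones: neither totality nor
-- decidability of the order is assumed (cotransitivity of _<_ follows from
-- that of _#_).
record RealField (c ℓ₁ ℓ₂ ℓ₃ : Level) : Set (lsuc (c ⊔ ℓ₁ ⊔ ℓ₂ ⊔ ℓ₃)) where
  field
    heytingField : HeytingField c ℓ₁ ℓ₂

  open HeytingField heytingField public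
  open HeytingCommutativeRing heytingCommutativeRing public
    using (commutativeRing)
  open CommutativeRing commutativeRing using (+-monoid)
  open Mult +-monoid public using () renaming (_×_ to _·_)

  infix 4 _<_ _≤_

  field
    _<_                  : Rel Carrier ℓ₃
    isStrictPartialOrder : IsStrictPartialOrder _≈_ _<_
    #⇒<⊎>                : ∀ {x y} → x # y → x < y ⊎ y < x
    <⇒#                  : ∀ {x y} → x < y → x # y
    +-monoʳ-<            : ∀ z {x y} → x < y → z + x < z + y
    *-pos                : ∀ {x y} → 0# < x → 0# < y → 0# < x * y

  _≤_ : Rel Carrier ℓ₃
  x ≤ y = ¬ (y < x)

  field
    archimedean : ∀ x → ∃ λ n → x < n · 1#
    -- If |f m - f m′| ≤ 1/(n+1) for all m, m′ ≥ n, then f has a limit l, with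
    -- |f m - l| ≤ 1/(n+1) for all m ≥ n.  Exchanging m and m′ gives the
    -- absolute value in the hypothesis.
    complete    : (f : ℕ → Carrier) →
                  (∀ n m m′ → n ℕ.≤ m → n ℕ.≤ m′ → suc n · (f m - f m′) ≤ 1#) →
                  ∃ λ l → ∀ n m → n ℕ.≤ m →
                    suc n · (f m - l) ≤ 1# × suc n · (l - f m) ≤ 1#

  private
    module SPO = IsStrictPartialOrder isStrictPartialOrder
    open HeytingProperties heytingCommutativeRing using (1#0; x-0≈x)
    open RingProperties (CommutativeRing.ring commutativeRing)
      using (-‿distribˡ-*; -‿involutive)

    0<1 : 0# < 1#
    0<1 with #⇒<⊎> 1#0
    ... | inj₂ 0<1 = 0<1
    ... | inj₁ 1<0 = ⊥-elim (SPO.asym 1<0 (SPO.<-respʳ-≈ [-1]²≈1 (*-pos 0<-1 0<-1)))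
      where
      0<-1 : 0# < - 1#
      0<-1 = SPO.<-respˡ-≈ (-‿inverseˡ 1#)
               (SPO.<-respʳ-≈ (+-identityʳ (- 1#)) (+-monoʳ-< (- 1#) 1<0))
      [-1]²≈1 : (- 1#) * (- 1#) ≈ 1#
      [-1]²≈1 = trans (sym (-‿distribˡ-* 1# (- 1#)))
                  (trans (-‿cong (*-identityˡ (- 1#))) (-‿involutive 1#))

    0<n·1 : ∀ n .{{_ : NonZero n}} → 0# < n · 1#
    0<n·1 (suc zero)    = SPO.<-respʳ-≈ (sym (+-identityʳ 1#)) 0<1
    0<n·1 (suc (suc n)) =
      SPO.trans 0<1 (SPO.<-respˡ-≈ (+-identityʳ 1#) (+-monoʳ-< 1# (0<n·1 (suc n))))

    n·1#0 : ∀ n .{{_ : NonZero n}} → n · 1# # 0#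
    n·1#0 n = #-sym (<⇒# (0<n·1 n))

  1/_ : ∀ n .{{_ : NonZero n}} → Carrier
  1/ n = proj₁ (#⇒invertible (n·1#0 n))

  1/-inverseˡ : ∀ n .{{_ : NonZero n}} → (1/ n) * (n · 1#) ≈ 1#
  1/-inverseˡ n = trans (*-congˡ (sym (x-0≈x (n · 1#))))
                    (proj₁ (proj₂ (#⇒invertible (n·1#0 n))))

  infixl 7 _/_

  _/_ : Carrier → (n : ℕ) → .{{NonZero n}} → Carrier
  x / n = x * (1/ n)

-- A cell's children are indexed by their position in the k × … × k grid.
data Spacetree (d k : ℕ) : Set where
  unrefined : Spacetree d k
  refined   : (Vec (Fin k) d → Spacetree d k) → Spacetree d k

module _ {d k : ℕ} where

  data Cell : Spacetree d k → Set where
    root : ∀ {t} → Cell t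
    into : ∀ {f} j → Cell (f j) → Cell (refined f)

  infix 4 _⊑_

  -- a ⊑ b: a is one of the k^d children of b.
  data _⊑_ : ∀ {t} → Cell t → Cell t → Set where
    here  : ∀ {f} j → into {f} j root ⊑ root
    there : ∀ {f} j {a b : Cell (f j)} → a ⊑ b → into {f} j a ⊑ into j b

  Refined : ∀ {t} → Cell t → Set
  Refined c = ∃ λ a → a ⊑ c

  Leaf : ∀ {t} → Cell t → Set
  Leaf c = ¬ Refined c

  data Event (t : Spacetree d k) : Set where
    enterCell leaveCell : Cell t → Event t

  Before : ∀ {t} → List (Event t) → Event t → Event t → Set
  Before es e e′ = (p : e ∈ es) (q : e′ ∈ es) → index p Fin.< index q

  record IsTraversal {t : Spacetree d k} (es : List (Event t)) : Set where
    field
      complete    : ∀ e → e ∈ es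
      unique      : Unique es
      enter-enter : ∀ {a b} → a ⊑ b → Before es (enterCell b) (enterCell a)
      leave-leave : ∀ {a b} → a ⊑ b → Before es (leaveCell a) (leaveCell b)
      enter-leave : ∀ c → Before es (enterCell c) (leaveCell c)

record Cube {c ℓ₁ ℓ₂ ℓ₃} (ℝ : RealField c ℓ₁ ℓ₂ ℓ₃) (d : ℕ) : Set c where
  open RealField ℝ using (Carrier)
  field
    corner : Vector Carrier d
    side   : Carrier

-- Ω is the computational domain, and Fin p the set of particles.
module PIT {c ℓ₁ ℓ₂ ℓ₃} (ℝ : RealField c ℓ₁ ℓ₂ ℓ₃)
           {d k : ℕ} .{{_ : NonTrivial k}}
           (𝒯 : Spacetree d k) (Ω : Cube ℝ d) (p : ℕ) where

  open RealField ℝ using (Carrier; commutativeRing; _+_; _·_; _/_; _≤_)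
  open VecEq (CommutativeRing.setoid commutativeRing) using (_≋_)
  open Cube

  Position : Set c
  Position = Vector Carrier d

  subcube : Cube ℝ d → Vec (Fin k) d → Cube ℝ d
  subcube Q j = record
    { corner = λ i → corner Q i + toℕ (lookup j i) · h
    ; side   = h
    }
    where
    instance k≢0 = nonTrivial⇒nonZero k
    h = side Q / k

  cube : ∀ {t} → Cube ℝ d → Cell t → Cube ℝ d
  cube Q root       = Q
  cube Q (into j a) = cube (subcube Q j) a

  -- Cells are closed, so a position on a common face lies in several cells.
  Covers : Cell 𝒯 → Position → Set ℓ₃
  Covers a x = ∀ i → corner Q i ≤ x i × x i ≤ corner Q i + side Q
    where Q = cube Ω a

  record State : Set c where
    field
      pos  : Fin p → Position
      cell : Fin p → Cell 𝒯

  open State public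

  Initial : State → Set ℓ₃
  Initial s = ∀ m → Leaf (cell s m) × Covers (cell s m) (pos s m)

  record ApplicationOps (s s′ : State) : Set ℓ₁ where
    field
      samePos  : ∀ m → pos s′ m ≋ pos s m
      sameCell : ∀ m → cell s′ m ≡ cell s m

  -- Which covering child is chosen is left open.  Nothing is assumed about the
  -- new cell if no child of the refined cell a covers the particle; thus that
  -- a covering child exists is a consequence, not a hypothesis, of a run.
  record Preamble (a : Cell 𝒯) (s s′ : State) : Set (ℓ₁ ⊔ ℓ₃) where
    field
      samePos  : ∀ m → pos s′ m ≋ pos s m
      others   : ∀ m → ¬ cell s m ≡ a → cell s′ m ≡ cell s m
      noDrop   : Leaf a → ∀ m → cell s′ m ≡ cell s m
      drop     : Refined a → ∀ m → cell s m ≡ a →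
                 (∃ λ b → b ⊑ a × Covers b (pos s m)) →
                 cell s′ m ⊑ a × Covers (cell s′ m) (pos s m)

  record Move (a : Cell 𝒯) (s s′ : State) : Set (ℓ₁ ⊔ ℓ₃) where
    field
      sameCell : ∀ m → cell s′ m ≡ cell s m
      others   : ∀ m → ¬ (Leaf a × cell s m ≡ a) → pos s′ m ≋ pos s m
      inDomain : ∀ m → Leaf a → cell s m ≡ a → Covers root (pos s′ m)

  -- Nothing is assumed about the new cell of a particle assigned to, but
  -- outside, the root, which has no parent; that particles stay within the
  -- domain excludes this case.
  record Epilogue (a : Cell 𝒯) (s s′ : State) : Set (ℓ₁ ⊔ ℓ₃) where
    field
      samePos  : ∀ m → pos s′ m ≋ pos s m
      others   : ∀ m → ¬ cell s m ≡ a → cell s′ m ≡ cell s m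
      noLift   : ∀ m → cell s m ≡ a → Covers a (pos s m) → cell s′ m ≡ a
      lift     : ∀ m → cell s m ≡ a → ¬ Covers a (pos s m) →
                 ∀ b → a ⊑ b → cell s′ m ≡ b

  Step : Event 𝒯 → Rel State (c ⊔ ℓ₁ ⊔ ℓ₃)
  Step (enterCell a) = Preamble a ; ApplicationOps ; Move a ; ApplicationOps
  Step (leaveCell a) = ApplicationOps ; Epilogue a

  data Run : List (Event 𝒯) → Rel State (c ⊔ ℓ₁ ⊔ ℓ₃) where
    []  : ∀ {s} → Run [] s s
    _∷_ : ∀ {e es s s′ s″} → Step e s s′ → Run es s′ s″ → Run (e ∷ es) s s″

{-# OPTIONS --safe #-}

-- During a traversal, a particle outside its cell can only be in a cell that
-- has been entered but not yet left: it got there by a move in this very cell,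
-- or by a lift from a child.  Hence cells not yet entered, or already left,
-- cover their particles; as a traversal leaves all cells, this holds for every
-- cell when the next traversal starts.
--
-- Covers is a negative statement, as x ≤ y means ¬ y < x, so it may be proved
-- by case distinction on undecidable propositions.

module Submission where

open import Defs
open import Algebra.Bundles using (CommutativeRing)
import Algebra.Properties.Semiring.Mult as SemiringMult
open import Data.Fin as Fin using (Fin; zero; suc; toℕ)
import Data.Fin.Properties as Fin
open import Data.List using (List; []; _∷_; _++_; _∷ʳ_; [_]; concat)
open import Data.List.Membership.Propositional using (_∈_; _∉_)
open import Data.List.Membership.Propositional.Properties
  using (∈-++⁺ˡ; ∈-++⁺ʳ; ∈-++⁻; ∈-insert)
open import Data.List.Properties using (∷-injective; ++-identityʳ; ++-assoc)
open import Data.List.Relation.Unary.All as All using (All; []; _∷_)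
open import Data.List.Relation.Unary.AllPairs using (_∷_)
open import Data.List.Relation.Unary.Any using (here; there; index)
open import Data.List.Relation.Unary.Unique.Propositional using (Unique)
open import Data.Nat as ℕ using (ℕ; suc; z≤n; s≤s; NonZero; NonTrivial; nonTrivial⇒nonZero)
import Data.Nat.Properties as ℕ
open import Data.Product using (∃; _×_; _,_; proj₁; proj₂)
open import Data.Sum using (_⊎_; inj₁; inj₂)
open import Data.Vec using (tabulate)
open import Data.Vec.Properties using (lookup∘tabulate)
open import Effect.Monad using (RawMonad)
open import Function using (_∘_)
open import Relation.Binary.PropositionalEquality as ≡ using (_≡_; refl; subst)
open import Relation.Binary.Structures using (IsStrictPartialOrder)
open import Relation.Nullary using (¬_; yes; no; contradiction)
open import Relation.Nullary.Decidable using (¬¬-excluded-middle)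
open import Relation.Nullary.Negation using (¬¬-Monad; ¬¬-map; negated-stable)

-- Positions and order of events in lists.

module _ {a} {A : Set a} where

  index-++⁺ˡ-< : ∀ {x y : A} {xs} ys (p : x ∈ xs) →
                 index (∈-++⁺ˡ {ys = y ∷ ys} p) Fin.< index (∈-insert {v = y} xs {ys})
  index-++⁺ˡ-< ys (here _)  = s≤s z≤n
  index-++⁺ˡ-< ys (there p) = s≤s (index-++⁺ˡ-< ys p)

  index-++⁺ʳ-≥ : ∀ {x y : A} xs {ys} (p : x ∈ y ∷ ys) →
                 index (∈-insert {v = y} xs {ys}) Fin.≤ index (∈-++⁺ʳ xs p)
  index-++⁺ʳ-≥ []       p = z≤n
  index-++⁺ʳ-≥ (_ ∷ xs) p = s≤s (index-++⁺ʳ-≥ xs p)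

  unique⇒∉ : ∀ {y : A} xs {ys} → Unique (xs ++ y ∷ ys) → y ∉ xs
  unique⇒∉ (x ∷ xs) (x≢ ∷ _) (here refl) = All.lookup x≢ (∈-insert xs) refl
  unique⇒∉ (x ∷ xs) (_ ∷ u)  (there p)   = unique⇒∉ xs u p

  -- Decides whether the marked event `z` belongs to the first traversal `xs` or to a later one.
  ++-splits : ∀ xs {ys : List A} ps {z zs} → xs ++ ys ≡ ps ++ z ∷ zs →
              (∃ λ us → xs ≡ ps ++ z ∷ us) ⊎
              (∃ λ us → ps ≡ xs ++ us × ys ≡ us ++ z ∷ zs)
  ++-splits []       ps       eq   = inj₂ (ps , refl , eq)
  ++-splits (x ∷ xs) []       refl = inj₁ (xs , refl)
  ++-splits (x ∷ xs) (_ ∷ ps) eq with ∷-injective eq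
  ... | refl , eq′ with ++-splits xs ps eq′
  ...   | inj₁ (us , refl)        = inj₁ (us , refl)
  ...   | inj₂ (us , refl , eq″) = inj₂ (us , refl , eq″)

module _ {d k} {t : Spacetree d k} {e e′ : Event t} (xs : List (Event t)) {ys : List (Event t)} where

  -- `Before` speaks of all occurrences, and an occurrence of `e′` in `e ∷ ys` has at least the
  -- index of the displayed `e`.
  Before⇒∈ : Before (xs ++ e ∷ ys) e′ e → e′ ∈ xs ++ e ∷ ys → e′ ∈ xs
  Before⇒∈ e′<e e′∈ with ∈-++⁻ xs e′∈
  ... | inj₁ p = p
  ... | inj₂ p = contradiction (e′<e (∈-++⁺ʳ xs p) (∈-insert xs))
                               (ℕ.≤⇒≯ (index-++⁺ʳ-≥ xs p))

  Before⇒∉ : Before (xs ++ e ∷ ys) e e′ → e′ ∉ xs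
  Before⇒∉ e<e′ p = ℕ.<-asym (e<e′ (∈-insert xs) (∈-++⁺ˡ p)) (index-++⁺ˡ-< ys p)

root-or-child : ∀ {d k} {t : Spacetree d k} (a : Cell t) → a ≡ root ⊎ ∃ λ b → a ⊑ b
root-or-child root       = inj₁ refl
root-or-child (into j a) with root-or-child a
... | inj₁ refl      = inj₂ (root , here j)
... | inj₂ (b , a⊑b) = inj₂ (into j b , there j a⊑b)

-- Subdivision of an interval into equal parts.

module _ {c ℓ₁ ℓ₂ ℓ₃} (ℝ : RealField c ℓ₁ ℓ₂ ℓ₃) where
  open RealField ℝ hiding (zero) renaming (refl to ≈-refl; sym to ≈-sym; trans to ≈-trans)
  open IsStrictPartialOrder isStrictPartialOrder using (asym; <-respˡ-≈; <-respʳ-≈)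
  open SemiringMult (CommutativeRing.semiring commutativeRing) using (×-comm-*; ×-congʳ)

  ≤-resp-≈ : ∀ {x x′ y y′} → x ≈ x′ → y ≈ y′ → x ≤ y → x′ ≤ y′
  ≤-resp-≈ x≈x′ y≈y′ x≤y y′<x′ =
    x≤y (<-respˡ-≈ (≈-sym y≈y′) (<-respʳ-≈ (≈-sym x≈x′) y′<x′))

  n·[x/n]≈x : ∀ n .{{_ : NonZero n}} x → n · (x / n) ≈ x
  n·[x/n]≈x n x =
    ≈-trans (≈-sym (×-comm-* n x (1/ n)))
    (≈-trans (*-congˡ (≈-trans (×-congʳ n (≈-sym (*-identityʳ (1/ n))))
                      (≈-trans (≈-sym (×-comm-* n (1/ n) 1#)) (1/-inverseˡ n))))
    (*-identityʳ x))

  -- Induction on `n`, cutting off the first part. Finding the part that contains `y` would require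
  -- comparing `y` with the cut points, which is undecidable; hence the double negation.
  interval-subdivision :
    ∀ n .{{_ : NonZero n}} h {l y} → l ≤ y → y ≤ l + n · h →
    ¬ ¬ ∃ λ (j : Fin n) → l + toℕ j · h ≤ y × y ≤ l + toℕ j · h + h
  interval-subdivision 1 h l≤y y≤ ¬∃ =
    ¬∃ (zero , ≤-resp-≈ (≈-sym (+-identityʳ _)) ≈-refl l≤y
             , ≤-resp-≈ ≈-refl (+-cong (≈-sym (+-identityʳ _)) (+-identityʳ h)) y≤)
  interval-subdivision (suc n@(suc _)) h {l} {y} l≤y y≤ ¬∃ =
    interval-subdivision n h l+h≤y (≤-resp-≈ ≈-refl (≈-sym (+-assoc l h _)) y≤)
      λ (j , lower , upper) →
        ¬∃ (suc j , ≤-resp-≈ (+-assoc l h _) ≈-refl lower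
                  , ≤-resp-≈ ≈-refl (+-congʳ (+-assoc l h _)) upper)
    where
    l+h≤y : l + h ≤ y
    -- As `≤` is a negated `<`, it suffices to refute `y < l + h`, which would put `y` into the
    -- first part.
    l+h≤y y<l+h = ¬∃ (zero , ≤-resp-≈ (≈-sym (+-identityʳ l)) ≈-refl l≤y
                           , ≤-resp-≈ ≈-refl (+-congʳ (≈-sym (+-identityʳ l))) (asym y<l+h))

module _ {c ℓ₁ ℓ₂ ℓ₃} (ℝ : RealField c ℓ₁ ℓ₂ ℓ₃)
         {d k : ℕ} .{{_ : NonTrivial k}}
         (𝒯 : Spacetree d k) (Ω : Cube ℝ d) (p : ℕ) where

  open RealField ℝ using (_≤_; _+_; _/_) renaming (_≈_ to _≈ᴿ_; refl to ≈-refl; sym to ≈-sym)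
  open PIT ℝ 𝒯 Ω p
  open Cube

  private
    instance
      k≢0 : NonZero k
      k≢0 = nonTrivial⇒nonZero k

  -- Covering of a refined cell by its children.

  Within : Cube ℝ d → Position → Set ℓ₃
  Within Q x = ∀ i → corner Q i ≤ x i × x i ≤ corner Q i + side Q

  -- Each coordinate is located separately, up to double negation; since there are finitely many
  -- coordinates, `Fin.sequence` merges the double negations into one.
  subcube-covering : ∀ Q {x} → Within Q x → ¬ ¬ ∃ λ j → Within (subcube Q j) x
  subcube-covering Q {x} x∈Q = ¬¬-map assemble (Fin.sequence rawApplicative λ i →
    interval-subdivision ℝ k (side Q / k) (proj₁ (x∈Q i))
      (≤-resp-≈ ℝ ≈-refl (RealField.+-congˡ ℝ (≈-sym (n·[x/n]≈x ℝ k (side Q))))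
        (proj₂ (x∈Q i))))
    where
    open RawMonad ¬¬-Monad using (rawApplicative)
    InSlab : ∀ i → Fin k → Set ℓ₃
    InSlab i j = corner Q i + toℕ j · h ≤ x i × x i ≤ corner Q i + toℕ j · h + h
      where open RealField ℝ using (_·_)
            h = side Q / k
    assemble : (∀ i → ∃ (InSlab i)) → ∃ λ j → Within (subcube Q j) x
    assemble slab = tabulate (proj₁ ∘ slab) , λ i →
      subst (InSlab i) (≡.sym (lookup∘tabulate (proj₁ ∘ slab) i)) (proj₂ (slab i))

  -- The given child `a` only witnesses that `b` is refined; the covering child `a′` may be another
  -- one. The recursion follows the path to `b`, shrinking `Q` along the way.
  child-covering : ∀ {t} {a b : Cell t} → a ⊑ b → ∀ Q {x} → Within (cube Q b) x →
                   ¬ ¬ ∃ λ a′ → a′ ⊑ b × Within (cube Q a′) x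
  child-covering (here _) Q x∈b =
    ¬¬-map (λ (j , x∈j) → into j root , here j , x∈j) (subcube-covering Q x∈b)
  child-covering (there j a⊑b) Q x∈b =
    ¬¬-map (λ (a′ , a′⊑b , x∈a′) → into j a′ , there j a′⊑b , x∈a′)
           (child-covering a⊑b (subcube Q j) x∈b)

  Covers-stable : ∀ a {x} → ¬ ¬ Covers a x → Covers a x
  Covers-stable _ ¬¬x∈a i = negated-stable (¬¬-map (λ x∈a → proj₁ (x∈a i)) ¬¬x∈a)
                        , negated-stable (¬¬-map (λ x∈a → proj₂ (x∈a i)) ¬¬x∈a)

  Covers-resp : ∀ {a a′ x x′} → a′ ≡ a → (∀ i → x′ i ≈ᴿ x i) → Covers a x → Covers a′ x′
  Covers-resp refl x′≈x x∈a i =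
    ≤-resp-≈ ℝ ≈-refl (≈-sym (x′≈x i)) (proj₁ (x∈a i)) ,
    ≤-resp-≈ ℝ (≈-sym (x′≈x i)) ≈-refl (proj₂ (x∈a i))

  -- The invariant and its transport.

  Active : List (Event 𝒯) → Cell 𝒯 → Set
  Active done a = enterCell a ∈ done × leaveCell a ∉ done

  -- The disjunction of Covers a x with the premise's negand, in ¬¬-stable form.
  -- A particle outside its cell has moved, so that it is known to be in Ω
  -- without using that cells are nested; this rules out a lift from the root.
  InPlace : List (Event 𝒯) → Cell 𝒯 → Position → Set ℓ₃
  InPlace done a x = ¬ (Active done a × Covers root x) → Covers a x

  Invariant : List (Event 𝒯) → State → Set ℓ₃
  Invariant done s = ∀ m → InPlace done (cell s m) (pos s m)

  InPlace-resp : ∀ {done a a′ x x′} → a′ ≡ a → (∀ i → x′ i ≈ᴿ x i) →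
                 InPlace done a x → InPlace done a′ x′
  InPlace-resp {a = a} refl x′≈x a∋x ¬active = Covers-resp {a} refl x′≈x (a∋x λ (active , x∈Ω) →
    ¬active (active , Covers-resp {root} refl x′≈x x∈Ω))

  InPlace-mono : ∀ {done done′ a x} → (Active done a → Active done′ a) →
                 InPlace done a x → InPlace done′ a x
  InPlace-mono active⁺ a∋x ¬active = a∋x λ (active , x∈Ω) → ¬active (active⁺ active , x∈Ω)

  Active-∷ʳ⁺ : ∀ {done e a} → ¬ leaveCell a ≡ e → Active done a → Active (done ∷ʳ e) a
  Active-∷ʳ⁺ {done} {e} {a} leave≢e (entered , ¬left) = ∈-++⁺ˡ entered , ¬left′
    where
    ¬left′ : leaveCell a ∉ done ∷ʳ e
    ¬left′ q with ∈-++⁻ done q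
    ... | inj₁ left     = ¬left left
    ... | inj₂ (here eq) = leave≢e eq

  applicationOps-preserves : ∀ {done s s′} → ApplicationOps s s′ →
                             Invariant done s → Invariant done s′
  applicationOps-preserves ops inv m = InPlace-resp (sameCell m) (samePos m) (inv m)
    where open ApplicationOps ops

  -- Preservation of the invariant by single events.

  module _ {done rest : List (Event 𝒯)} where

    module _ {a : Cell 𝒯} (traversal : IsTraversal (done ++ enterCell a ∷ rest)) where
      open IsTraversal traversal

      -- The only `enterCell a` of the traversal is the current event, so `a` is not yet active and
      -- the exception in `InPlace` cannot apply.
      entering⇒covered : ∀ {x} → InPlace done a x → Covers a x
      entering⇒covered a∋x = a∋x λ ((entered , _) , _) → unique⇒∉ done unique entered

      entered-active : Active (done ∷ʳ enterCell a) a
      entered-active = ∈-++⁺ʳ done (here refl) , ¬left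
        where
        ¬left : leaveCell a ∉ done ∷ʳ enterCell a
        ¬left q with ∈-++⁻ done q
        ... | inj₁ left = Before⇒∉ done (enter-leave a) left
        ... | inj₂ (here ())

      -- Particles found in `a` are still covered by it, so if `a` is refined, a covering child
      -- exists up to double negation and `drop` applies; the double negation is absorbed because
      -- `Covers` is stable.
      preamble-preserves : ∀ {s s′} → Preamble a s s′ → Invariant done s →
                           Invariant (done ∷ʳ enterCell a) s′
      preamble-preserves {s} {s′} preamble inv m ¬active = Covers-stable (cell s′ m) λ s′∌m →
        ¬¬-excluded-middle λ where
          (no s≢a) → s′∌m (InPlace-resp (others m s≢a) (samePos m)
                            (InPlace-mono (Active-∷ʳ⁺ λ ()) (inv m)) ¬active)
          (yes s≡a) →
            let x∈a = entering⇒covered (subst (λ b → InPlace done b (pos s m)) s≡a (inv m)) in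
            ¬¬-excluded-middle λ where
              (no leaf) → s′∌m (Covers-resp (≡.trans (noDrop leaf m) s≡a) (samePos m) x∈a)
              (yes (b , b⊑a)) → child-covering b⊑a Ω x∈a λ child →
                s′∌m (Covers-resp {cell s′ m} refl (samePos m) (proj₂ (drop (b , b⊑a) m s≡a child)))
        where open Preamble preamble

      -- A moved particle may leave its cell, but that cell is `a`, which has just become active,
      -- and the particle stays in the domain: exactly the exception that `InPlace` permits.
      move-preserves : ∀ {s s′} → Move a s s′ → Invariant (done ∷ʳ enterCell a) s →
                       Invariant (done ∷ʳ enterCell a) s′
      move-preserves {s} {s′} move inv m ¬active = Covers-stable (cell s′ m) λ s′∌m →
        ¬¬-excluded-middle λ where
          (no ¬moved) → s′∌m (InPlace-resp (sameCell m) (others m ¬moved) (inv m) ¬active)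
          (yes (leaf , s≡a)) →
            ¬active ( subst (Active _) (≡.sym (≡.trans (sameCell m) s≡a)) entered-active
                    , inDomain m leaf s≡a)
        where open Move move

    module _ {a : Cell 𝒯} (traversal : IsTraversal (done ++ leaveCell a ∷ rest)) where
      open IsTraversal traversal

      -- Makes a lift harmless: the receiving cell is still open, so it need not cover the particle.
      parent-active : ∀ {b} → a ⊑ b → Active (done ∷ʳ leaveCell a) b
      parent-active {b} a⊑b = Active-∷ʳ⁺ leave≢ (b-entered , Before⇒∉ done (leave-leave a⊑b))
        where
        a-entered : enterCell a ∈ done
        a-entered = Before⇒∈ done (enter-leave a) (complete (enterCell a))
        b-entered : enterCell b ∈ done
        b-entered = Before⇒∈ done
          -- The order of `enterCell b` and `leaveCell a` follows through `enterCell a`, which lies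
          -- between them.
          (λ q r → ℕ.<-trans (enter-enter a⊑b q (complete (enterCell a)))
                             (enter-leave a (complete (enterCell a)) r))
          (complete (enterCell b))
        leave≢ : ¬ leaveCell b ≡ leaveCell a
        leave≢ refl = ℕ.<-irrefl refl (leave-leave a⊑b (∈-insert done) (∈-insert done))

      epilogue-preserves : ∀ {s s′} → Epilogue a s s′ → Invariant done s →
                           Invariant (done ∷ʳ leaveCell a) s′
      epilogue-preserves {s} {s′} epilogue inv m ¬active = Covers-stable (cell s′ m) λ s′∌m →
        ¬¬-excluded-middle λ where
          (no s≢a) → s′∌m (InPlace-resp (others m s≢a) (samePos m)
                            -- Only `a` ceases to be active, and this particle is assigned
                            -- elsewhere.
                            (InPlace-mono (Active-∷ʳ⁺ λ { refl → s≢a refl }) (inv m)) ¬active)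
          (yes s≡a) → ¬¬-excluded-middle λ where
            (yes x∈a) → s′∌m (Covers-resp (noLift m s≡a x∈a) (samePos m) x∈a)
            -- The invariant is used for `x∈Ω`: a particle outside `a` must be in the exceptional
            -- case. If `a` is the root, `x∈Ω` contradicts `x∉a`; otherwise the particle is lifted
            -- to an active parent.
            (no x∉a) → x∉a (subst (λ b → Covers b (pos s m)) s≡a (inv m λ (_ , x∈Ω) →
              lifted s≡a x∉a x∈Ω (root-or-child a)))
        where
        open Epilogue epilogue
        lifted : cell s m ≡ a → ¬ Covers a (pos s m) → Covers root (pos s m) →
                 ¬ (a ≡ root ⊎ ∃ λ b → a ⊑ b)
        lifted s≡a x∉a x∈Ω (inj₁ refl)      = x∉a x∈Ω
        lifted s≡a x∉a x∈Ω (inj₂ (b , a⊑b)) =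
          ¬active ( subst (Active _) (≡.sym (lift m s≡a x∉a b a⊑b)) (parent-active a⊑b)
                  , Covers-resp {root} refl (samePos m) x∈Ω)

    step-preserves : ∀ {e s s′} → IsTraversal (done ++ e ∷ rest) → Step e s s′ →
                     Invariant done s → Invariant (done ∷ʳ e) s′
    step-preserves {enterCell a} traversal (_ , preamble , _ , ops , _ , move , ops′) =
      applicationOps-preserves ops′ ∘ move-preserves traversal move ∘
      applicationOps-preserves ops ∘ preamble-preserves traversal preamble
    step-preserves {leaveCell a} traversal (_ , ops , epilogue) =
      epilogue-preserves traversal epilogue ∘ applicationOps-preserves ops

  -- Runs and sequences of traversals.

  -- The pending events `rest` allow the run to stop in the middle of a traversal, as it does when a
  -- leaf is entered.
  run-preserves : ∀ done es {rest s s′} → IsTraversal (done ++ es ++ rest) → Run es s s′ →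
                  Invariant done s → Invariant (done ++ es) s′
  run-preserves done [] traversal [] inv =
    subst (λ es → Invariant es _) (≡.sym (++-identityʳ done)) inv
  run-preserves done (e ∷ es) {rest} traversal (step ∷ run) inv =
    subst (λ es → Invariant es _) (++-assoc done [ e ] es)
      (run-preserves (done ∷ʳ e) es
        (subst IsTraversal (≡.sym (++-assoc done [ e ] (es ++ rest))) traversal) run
        (step-preserves traversal step inv))

  Run-++⁻ : ∀ es {es′ s s″} → Run (es ++ es′) s s″ → ∃ λ s′ → Run es s s′ × Run es′ s′ s″
  Run-++⁻ []       run          = _ , [] , run
  Run-++⁻ (e ∷ es) (step ∷ run) with Run-++⁻ es run
  ... | s′ , run₁ , run₂ = s′ , step ∷ run₁ , run₂

  -- The part of `Initial` that survives a traversal: after lifts, particles may be assigned to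
  -- refined cells.
  CoveredByCells : State → Set ℓ₃
  CoveredByCells s = ∀ m → Covers (cell s m) (pos s m)

  traversal-preserves : ∀ {es s s′} → IsTraversal es → Run es s s′ →
                        CoveredByCells s → CoveredByCells s′
  traversal-preserves {es} {s} {s′} traversal run covered m =
    run-preserves [] es (subst IsTraversal (≡.sym (++-identityʳ es)) traversal) run
      (λ m _ → covered m) m
      λ ((_ , ¬left) , _) → ¬left (IsTraversal.complete traversal (leaveCell (cell s′ m)))

  -- Induction on the traversals. Those contained in `past` are run completely and preserve
  -- coverage; the one containing the event is run only up to it, where the invariant yields the
  -- claim.
  entered-leaf-covers :
    ∀ {s₀} → CoveredByCells s₀ →
    ∀ {traversals} → All IsTraversal traversals →
    ∀ past {a future} → concat traversals ≡ past ++ enterCell a ∷ future → Leaf a →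
    ∀ {s s′} → Run past s₀ s → Preamble a s s′ →
    ∀ m → cell s′ m ≡ a → Covers a (pos s′ m)
  entered-leaf-covers covered []       []      ()
  entered-leaf-covers covered []       (_ ∷ _) ()
  entered-leaf-covers covered {es ∷ _} (traversal ∷ traversals) past {a} eq leaf {s} run preamble m s′≡a
    with ++-splits es past eq
  ... | inj₁ (us , refl) =
    Covers-resp {a} refl (samePos m) (entering⇒covered traversal
      -- The preamble of a leaf reassigns nothing, so the particle was in `a` already before it.
      (subst (λ b → InPlace past b (pos s m)) (≡.trans (≡.sym (noDrop leaf m)) s′≡a)
        (run-preserves [] past traversal run (λ m _ → covered m) m)))
    where open Preamble preamble
  ... | inj₂ (past′ , refl , eq′) with Run-++⁻ es run
  ...   | _ , run₁ , run₂ =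
    entered-leaf-covers (traversal-preserves traversal run₁ covered) traversals
      past′ eq′ leaf run₂ preamble m s′≡a

theorem5p1 : ∀ {c ℓ₁ ℓ₂ ℓ₃} (ℝ : RealField c ℓ₁ ℓ₂ ℓ₃)
    (d k : ℕ) .{{_ : NonTrivial k}} → d ≡ 2 ⊎ d ≡ 3 →
    (𝒯 : Spacetree d k) (Ω : Cube ℝ d) →
    RealField._<_ ℝ (RealField.0# ℝ) (Cube.side Ω) →
    (p : ℕ) →
    let open PIT ℝ 𝒯 Ω p in
    (s₀ : State) → Initial s₀ →
    (traversals : List (List (Event 𝒯))) → All IsTraversal traversals →
    ∀ past a future → concat traversals ≡ past ++ enterCell a ∷ future → Leaf a →
    ∀ s s′ → Run past s₀ s → Preamble a s s′ →
    ∀ m → cell s′ m ≡ a → Covers a (pos s′ m)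
theorem5p1 ℝ d k _ 𝒯 Ω _ p s₀ initial _ traversals past _ _ eq leaf _ _ run preamble =
  entered-leaf-covers ℝ 𝒯 Ω p (proj₂ ∘ initial) traversals past eq leaf run preamble
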